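{- Let $G$ be a connected graph with $\chi(G)=k\ge 3$. Suppose $\mathscr C_0$ is an extendable coloring of $G[S]$ for some $S\subset V(G)$. If there is an edge $xy$ of $G$ with $x,y\notin S$ such that $\deg(x)\le k-1$ and $\deg(y)\le k-1$, then $\mathscr C_0$ is not a Sudoku coloring of $G$.
   Context: Graphs are finite, undirected and simple. Let $G=(V,E)$ be a connected graph with chromatic number $\chi(G)=k\ge 2$. For $S\subset V$, let $\mathscr C_0$ be a proper coloring of the induced subgraph $G[S]$ with colors from $\{1,\dots,k\}$ (not all colors need be used). An extension of $\mathscr C_0$ is a proper $k$-coloring $V\to\{1,\dots,k\}$ of $G$ whose restriction to $S$ is $\mathscr C_0$. $\mathscr C_0$ is extendable if it has at least one extension, and is a Sudoku coloring of $G$ if it has exactly one extension. -}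

module Defs where

open import Data.Fin.Base using (Fin)
open import Data.Fin.Subset using (Subset; _∈_; ∣_∣)
open import Data.Nat.Base using (ℕ; _≤_)
open import Data.Product using (∃; ∃!; _×_; proj₁)
open import Data.Vec.Base using (tabulate)
open import Function.Base using (_on_)
open import Relation.Binary.Construct.Closure.ReflexiveTransitive using (Star)
open import Relation.Binary.Core using (Rel)
open import Relation.Binary.Definitions using (Decidable; Irreflexive; Symmetric)
open import Relation.Binary.PropositionalEquality using (_≡_; _≢_; _≗_; refl)
open import Relation.Nullary.Decidable.Core using (does)
open import Level using (0ℓ)

-- Finite graphs are those with V = Fin n.
record Graph (V : Set) : Set₁ where
  field
    Adj    : Rel V 0ℓ
    adj?   : Decidable Adj
    sym    : Symmetric Adj
    irrefl : Irreflexive _≡_ Adj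

open Graph public using (Adj)

-- The factor V excludes the empty graph.
Connected : {V : Set} → Graph V → Set
Connected {V} G = V × (∀ u v → Star (Adj G) u v)

neighbours : {n : ℕ} → Graph (Fin n) → Fin n → Subset n
neighbours G v = tabulate (λ w → does (Graph.adj? G v w))

deg : {n : ℕ} → Graph (Fin n) → Fin n → ℕ
deg G v = ∣ neighbours G v ∣

Vertices : {n : ℕ} → Subset n → Set
Vertices S = ∃ (_∈ S)

infix 8 _[_]

-- The induced subgraph G[S].
_[_] : {n : ℕ} → Graph (Fin n) → (S : Subset n) → Graph (Vertices S)
G [ S ] = record
  { Adj    = Adj G on proj₁
  ; adj?   = λ u v → Graph.adj? G (proj₁ u) (proj₁ v)
  ; sym    = Graph.sym G
  ; irrefl = λ { refl → Graph.irrefl G refl }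
  }

-- The colors 1, …, k are represented by Fin k.
Proper : {V : Set} {k : ℕ} → Graph V → (V → Fin k) → Set
Proper G c = ∀ {u v} → Adj G u v → c u ≢ c v

Colorable : {V : Set} → Graph V → ℕ → Set
Colorable {V} G k = ∃ λ (c : V → Fin k) → Proper G c

-- χ(G) = k.
HasChromaticNumber : {V : Set} → Graph V → ℕ → Set
HasChromaticNumber G k = Colorable G k × (∀ j → Colorable G j → k ≤ j)

module _ {n k : ℕ} (G : Graph (Fin n)) {S : Subset n} (C₀ : Vertices S → Fin k) where

  IsExtension : (Fin n → Fin k) → Set
  IsExtension c = Proper G c × (∀ s → c (proj₁ s) ≡ C₀ s)

  Extendable : Set
  Extendable = ∃ IsExtension

  -- Uniqueness is up to pointwise equality of colorings.
  IsSudoku : Set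
  IsSudoku = ∃! _≗_ IsExtension

{-# OPTIONS --safe #-}

-- Let c be the only extension. A vertex v ∉ S of degree at most k − 1 cannot be
-- recolored, so each of the k − 1 colors other than c v occurs among its
-- neighbours, hence exactly once. For an edge xy of two such vertices, y is then the
-- only neighbour of x colored c y and x the only neighbour of y colored c x,
-- so exchanging the colors of x and y gives a second extension.
module Submission where

open import Defs
open import Data.Fin.Base using (Fin; zero; suc)
open import Data.Fin.Properties using (_≟_; any?)
open import Data.Fin.Subset
  using (Subset; inside; outside; _∈_; _∉_; ∣_∣; _-_; ⁅_⁆; ⊤)
open import Data.Fin.Subset.Properties
  using ( drop-there; ∣⊤∣≡n; x∈p⇒∣p-x∣<∣p∣; x∈p∧x≢y⇒x∈p-y; p─q⊆p
        ; p─⊥≡p; nonempty?; Empty-unique; ∣⊥∣≡0)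
open import Data.Nat.Base using (ℕ; _≤_; _∸_; suc; s≤s)
open import Data.Nat.Properties
  using (≤-reflexive; ≤-trans; n≤1+n; <-irrefl; module ≤-Reasoning; pred-mono-≤)
open import Data.Product using (∃-syntax; _×_; _,_; proj₁; proj₂)
open import Data.Unit.Base using (tt)
open import Data.Vec.Base using ([]; _∷_; there)
open import Data.Vec.Functional using (updateAt)
open import Data.Vec.Functional.Properties using (updateAt-updates; updateAt-minimal)
open import Data.Vec.Properties using (lookup∘tabulate; lookup⇒[]=)
open import Function.Base using (_∘_; const)
open import Relation.Binary.PropositionalEquality
  using (_≡_; _≢_; _≗_; refl; sym; trans; cong)
open import Relation.Nullary.Decidable using (yes; no; dec-true; _×-dec_; decidable-stable)
open import Relation.Nullary.Negation.Core using (¬_; contradiction)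
open import Relation.Unary using (U)

private variable
  n k : ℕ

∣p∣≤1+∣p-x∣ : (p : Subset n) (x : Fin n) → ∣ p ∣ ≤ suc ∣ p - x ∣
∣p∣≤1+∣p-x∣ (inside  ∷ p) zero    = s≤s (≤-reflexive (cong ∣_∣ (sym (p─⊥≡p p))))
∣p∣≤1+∣p-x∣ (outside ∷ p) zero    =
  ≤-trans (n≤1+n _) (s≤s (≤-reflexive (cong ∣_∣ (sym (p─⊥≡p p)))))
∣p∣≤1+∣p-x∣ (inside  ∷ p) (suc x) = s≤s (∣p∣≤1+∣p-x∣ p x)
∣p∣≤1+∣p-x∣ (outside ∷ p) (suc x) = ∣p∣≤1+∣p-x∣ p x

x∈p-y⇒x≢y : (p : Subset n) {x y : Fin n} → x ∈ p - y → x ≢ y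
x∈p-y⇒x≢y (inside  ∷ p) {zero} () refl
x∈p-y⇒x≢y (outside ∷ p) {zero} () refl
x∈p-y⇒x≢y (_ ∷ p) {suc x} x∈ refl = x∈p-y⇒x≢y p (drop-there x∈) refl

-- Pigeonhole by induction on `p`. Dropping the first element of `p` can uncover only its color
-- `f zero`, so removing that color from `q` keeps the covering hypothesis and costs `q` at most one
-- element. Once `p` is exhausted, any color left in `q` would lack a witness.
covered⇒∣q∣≤∣p∣ : (f : Fin n → Fin k) (p : Subset n) (q : Subset k) →
  (∀ {d} → d ∈ q → ∃[ v ] v ∈ p × f v ≡ d) → ∣ q ∣ ≤ ∣ p ∣
covered⇒∣q∣≤∣p∣ {k = k} f [] q cover with nonempty? q
... | yes (_ , d∈q) with () ← proj₁ (cover d∈q)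
... | no  empty     = ≤-reflexive (trans (cong ∣_∣ (Empty-unique empty)) (∣⊥∣≡0 k))
covered⇒∣q∣≤∣p∣ f (outside ∷ p) q cover = covered⇒∣q∣≤∣p∣ (f ∘ suc) p q cover′
  where
  cover′ : ∀ {d} → d ∈ q → ∃[ v ] v ∈ p × f (suc v) ≡ d
  cover′ d∈q with cover d∈q
  ... | suc v , there v∈p , eq = v , v∈p , eq
covered⇒∣q∣≤∣p∣ f (inside ∷ p) q cover =
  ≤-trans (∣p∣≤1+∣p-x∣ q (f zero)) (s≤s (covered⇒∣q∣≤∣p∣ (f ∘ suc) p (q - f zero) cover′))
  where
  cover′ : ∀ {d} → d ∈ q - f zero → ∃[ v ] v ∈ p × f (suc v) ≡ d
  cover′ d∈ with cover (p─q⊆p q ⁅ f zero ⁆ d∈)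
  ... | zero  , _         , eq = contradiction (sym eq) (x∈p-y⇒x≢y q d∈)
  ... | suc v , there v∈p , eq = v , v∈p , eq

recolor : (Fin n → Fin k) → Fin n → Fin k → Fin n → Fin k
recolor c x d = updateAt c x (const d)

module _ (G : Graph (Fin n)) where

  private
    adj-sym : ∀ {u v} → Adj G u v → Adj G v u
    adj-sym = Graph.sym G

  adj⇒≢ : ∀ {u v} → Adj G u v → u ≢ v
  adj⇒≢ uv refl = Graph.irrefl G refl uv

  adj⇒∈neighbours : ∀ {v w} → Adj G v w → w ∈ neighbours G v
  adj⇒∈neighbours {v} {w} vw =
    lookup⇒[]= w _ (trans (lookup∘tabulate _ w) (dec-true (Graph.adj? G v w) vw))

  -- Once `x` has taken the color of `y`, and until `y` is recolored in turn, the edge between them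
  -- is monochromatic. Restricting to `P` allows the intermediate coloring to be treated as proper
  -- away from `y`.
  ProperOn : (Fin n → Set) → (Fin n → Fin k) → Set
  ProperOn P c = ∀ {u v} → P u → P v → Adj G u v → c u ≢ c v

  -- The old color of `x` is overwritten, so conflicts of `c` at `x` are harmless; only the new
  -- color `d` has to be absent from the neighbours of `x` in `P`.
  recolor-properOn : {P : Fin n → Set} {c : Fin n → Fin k} {x : Fin n} {d : Fin k} →
    ProperOn (λ v → P v × v ≢ x) c → (∀ {w} → P w → Adj G x w → c w ≢ d) →
    ProperOn P (recolor c x d)
  recolor-properOn {c = c} {x} {d} proper free {u} {v} Pu Pv uv
    with u ≟ x | v ≟ x
  ... | yes refl | yes refl = contradiction refl (adj⇒≢ uv)
  ... | yes refl | no v≢x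
    rewrite updateAt-updates u {const d} c | updateAt-minimal v u {const d} c v≢x
    = free Pv uv ∘ sym
  ... | no u≢x | yes refl
    rewrite updateAt-updates v {const d} c | updateAt-minimal u v {const d} c u≢x
    = free Pu (adj-sym uv)
  ... | no u≢x | no v≢x
    rewrite updateAt-minimal u x {const d} c u≢x | updateAt-minimal v x {const d} c v≢x
    = proper (Pu , u≢x) (Pv , v≢x) uv

  module _ {S : Subset n} {C₀ : Vertices S → Fin k} where

    recolor-agrees : ∀ {c x d} → x ∉ S → (∀ s → c (proj₁ s) ≡ C₀ s) →
      ∀ s → recolor c x d (proj₁ s) ≡ C₀ s
    recolor-agrees {c} {x} x∉S agrees s@(v , v∈S) =
      trans (updateAt-minimal v x c λ { refl → x∉S v∈S }) (agrees s)

    module _ {c : Fin n → Fin k} (ext : IsExtension G C₀ c)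
             (unique : ∀ {c′} → IsExtension G C₀ c′ → c ≗ c′) where

      -- Otherwise `x` could be recolored `d`: the result is proper and, since `x ∉ S`, still
      -- extends `C₀`, so uniqueness would force `d ≡ c x`. Finite search over decidable conditions
      -- then turns this contradiction into an actual neighbour.
      other-color-occurs : ∀ {x} → x ∉ S → ∀ {d} → d ≢ c x →
        ∃[ w ] Adj G x w × c w ≡ d
      other-color-occurs {x} x∉S {d} d≢cx =
        decidable-stable (any? λ w → Graph.adj? G x w ×-dec (c w ≟ d)) λ none →
          d≢cx (sym (trans (unique (recolored none) x) (updateAt-updates x c)))
        where
        recolored : ¬ (∃[ w ] Adj G x w × c w ≡ d) → IsExtension G C₀ (recolor c x d)
        recolored none =
          (λ uv → recolor-properOn {P = U} (λ _ _ → proj₁ ext)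
             (λ {w} _ xw eq → none (w , xw , eq)) tt tt uv)
          , recolor-agrees x∉S (proj₂ ext)

      -- If two distinct neighbours shared a color, one could be discarded and the rest would still
      -- show all `k ∸ 1` colors other than `c x`, which forces the degree above `k ∸ 1`.
      neighbours-distinctly-colored : ∀ {x} → x ∉ S → deg G x ≤ k ∸ 1 →
        ∀ {w w′} → Adj G x w → Adj G x w′ → c w ≡ c w′ → w ≡ w′
      neighbours-distinctly-colored {x} x∉S deg≤ {w} {w′} xw xw′ cw≡cw′ =
        decidable-stable (w ≟ w′) λ w≢w′ → <-irrefl refl (begin-strict
          k ∸ 1                   ≡⟨ cong (_∸ 1) (∣⊤∣≡n k) ⟨
          ∣ ⊤ {k} ∣ ∸ 1           ≤⟨ pred-mono-≤ (∣p∣≤1+∣p-x∣ ⊤ (c x)) ⟩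
          ∣ ⊤ - c x ∣             ≤⟨ covered⇒∣q∣≤∣p∣ c _ _ (cover w≢w′) ⟩
          ∣ neighbours G x - w′ ∣ <⟨ x∈p⇒∣p-x∣<∣p∣ (adj⇒∈neighbours xw′) ⟩
          deg G x                 ≤⟨ deg≤ ⟩
          k ∸ 1                   ∎)
        where
        open ≤-Reasoning
        cover : w ≢ w′ → ∀ {d} → d ∈ ⊤ - c x →
          ∃[ v ] v ∈ neighbours G x - w′ × c v ≡ d
        cover w≢w′ d∈ with other-color-occurs x∉S (x∈p-y⇒x≢y ⊤ d∈)
        ... | v , xv , refl with v ≟ w′
        -- The discarded neighbour is replaced by `w`, which has the same color.
        ...   | yes refl = w , x∈p∧x≢y⇒x∈p-y (adj⇒∈neighbours xw) w≢w′ , cw≡cw′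
        ...   | no v≢w′  = v , x∈p∧x≢y⇒x∈p-y (adj⇒∈neighbours xv) v≢w′ , refl

lemma2p7 : {n k : ℕ} (G : Graph (Fin n)) → Connected G →
    HasChromaticNumber G k → 3 ≤ k →
    (S : Subset n) (C₀ : Vertices S → Fin k) →
    Proper (G [ S ]) C₀ → Extendable G C₀ →
    (x y : Fin n) → Adj G x y → x ∉ S → y ∉ S →
    deg G x ≤ k ∸ 1 → deg G y ≤ k ∸ 1 →
    ¬ IsSudoku G C₀
lemma2p7 {n} {k} G _ _ _ S C₀ _ _ x y xy x∉S y∉S degx≤ degy≤
  (c , ext@(proper , agrees) , unique) =
  -- Uniqueness equates `c` with the swapped coloring; at `x` this gives `c x ≡ c y`, against
  -- properness on the edge.
  proper xy (trans (unique (swapped-proper , swapped-agrees) x) swapped-x)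
  where
  yx : Adj G y x
  yx = Graph.sym G xy

  swapped : Fin n → Fin k
  swapped = recolor (recolor c x (c y)) y (c x)

  swapped-x : swapped x ≡ c y
  swapped-x = trans (updateAt-minimal x y _ (adj⇒≢ G xy)) (updateAt-updates x c)

  swapped-agrees : ∀ s → swapped (proj₁ s) ≡ C₀ s
  swapped-agrees = recolor-agrees G {C₀ = C₀} y∉S (recolor-agrees G {C₀ = C₀} x∉S agrees)

  -- `y` is exempt because it still has color `c y` at this stage; it is the only such neighbour of
  -- `x`.
  x-free : ∀ {w} → U w × w ≢ y → Adj G x w → c w ≢ c y
  x-free (_ , w≢y) xw =
    w≢y ∘ neighbours-distinctly-colored G ext unique x∉S degx≤ xw xy

  y-free : ∀ {w} → U w → Adj G y w → recolor c x (c y) w ≢ c x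
  y-free {w} _ yw eq with w ≟ x
  -- By now `x` carries `c y`, so it no longer blocks the color `c x` for `y`.
  ... | yes refl = proper xy (trans (sym eq) (updateAt-updates x c))
  ... | no w≢x   = w≢x (neighbours-distinctly-colored G ext unique y∉S degy≤ yw yx
                          (trans (sym (updateAt-minimal w x c w≢x)) eq))

  swapped-proper : Proper G swapped
  swapped-proper = recolor-properOn G {P = U}
    (recolor-properOn G {P = λ v → U v × v ≢ y} (λ _ _ → proper) x-free) y-free tt tt
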